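{- Let $n=p_1^{r_1}p_2^{r_2}\cdots p_k^{r_k}\ge 2$, where $p_1,\ldots,p_k$ are distinct primes and $r_i\ge1$. Then $\theta_t(G(n))=k$, and there is exactly one total clique covering of $G(n)$ consisting of precisely $k$ cliques.
   Context: For an integer $n\ge2$, $G(n)$ is the simple undirected graph whose vertex set is the set of divisors of $n$ greater than $1$, two distinct vertices $a,b$ being adjacent iff $\gcd(a,b)>1$. A clique is a set of pairwise adjacent vertices; a set $S$ of cliques of a graph is a total clique covering if every vertex lies in some member of $S$ and every edge has both endpoints in some member of $S$. $\theta_t(G)$ denotes the minimum size of a total clique covering of $G$. -}

module Defs where

open import Level using (0ℓ)
open import Data.Nat using (ℕ; suc; _≤_; _<_; _<?_)
open import Data.Nat.Divisibility using (_∣?_)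
open import Data.Nat.GCD using (gcd; gcd-comm)
open import Data.Fin using (Fin; toℕ)
open import Data.Fin.Subset using (Subset; _∈_; _⊆_)
open import Data.List using (List; length)
open import Data.List.Relation.Binary.BagAndSetEquality using (_∼[_]_; set)
open import Data.List.Relation.Unary.All using (All)
open import Data.List.Relation.Unary.Any using (Any)
open import Data.List.Relation.Unary.Unique.Propositional using (Unique)
open import Data.Product using (_×_; _,_; ∃; ∃!; proj₁)
open import Data.Vec using (tabulate)
open import Function using (_∘_)
open import Relation.Binary using (Rel; Symmetric)
open import Relation.Binary.PropositionalEquality using (_≡_; _≢_; refl; sym; subst)
open import Relation.Nullary using (¬_; does)
open import Relation.Nullary.Decidable using (_×-dec_)

-- A simple undirected graph whose vertex set is a subset of the ambient
-- finite type Fin m.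
record SimpleGraph (m : ℕ) : Set₁ where
  field
    vertices   : Subset m
    Adj        : Rel (Fin m) 0ℓ
    Adj-vertex : ∀ {a b} → Adj a b → a ∈ vertices
    Adj-sym    : Symmetric Adj
    Adj-irrefl : ∀ {a} → ¬ Adj a a

open SimpleGraph public

module _ {m : ℕ} (Γ : SimpleGraph m) where

  IsClique : Subset m → Set
  IsClique C = C ⊆ vertices Γ
             × (∀ {a b} → a ∈ C → b ∈ C → a ≢ b → Adj Γ a b)

  -- A finite set of cliques is a duplicate-free list, so its size is the
  -- length; two such lists denote the same set iff they are related by
  -- _∼[ set ]_.  (Equality of Subsets is equality of the sets they denote.)
  record IsTotalCliqueCovering (S : List (Subset m)) : Set where
    field
      distinct      : Unique S
      cliques       : All IsClique S
      covers-vertex : ∀ {v} → v ∈ vertices Γ → Any (λ C → v ∈ C) S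
      covers-edge   : ∀ {a b} → Adj Γ a b → Any (λ C → a ∈ C × b ∈ C) S

  -- The relation "θₜ(Γ) = k": k is the minimum of the sizes of the total
  -- clique coverings of Γ.
  IsTotalCliqueCoveringNumber : ℕ → Set
  IsTotalCliqueCoveringNumber k =
      (∃ λ S → IsTotalCliqueCovering S × length S ≡ k)
    × (∀ S → IsTotalCliqueCovering S → k ≤ length S)

  UniqueTotalCliqueCoveringOfSize : ℕ → Set
  UniqueTotalCliqueCoveringOfSize k =
    ∃! (λ S T → S ∼[ set ] T) (λ S → IsTotalCliqueCovering S × length S ≡ k)

-- For n ≥ 1 every divisor of n is at most n, so Fin (suc n) is large enough.
divisors>1 : (n : ℕ) → Subset (suc n)
divisors>1 n = tabulate (λ i → does (1 <? toℕ i ×-dec toℕ i ∣? n))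

G : (n : ℕ) → SimpleGraph (suc n)
G n = record
  { vertices   = divisors>1 n
  ; Adj        = λ a b → a ∈ divisors>1 n × b ∈ divisors>1 n
                       × a ≢ b × 1 < gcd (toℕ a) (toℕ b)
  ; Adj-vertex = proj₁
  ; Adj-sym    = λ {a} {b} (a∈ , b∈ , a≢b , 1<g) →
                   b∈ , a∈ , a≢b ∘ sym , subst (1 <_) (gcd-comm (toℕ a) (toℕ b)) 1<g
  ; Adj-irrefl = λ (_ , _ , a≢a , _) → a≢a refl
  }

{-# OPTIONS --safe #-}
-- The primes p i are pairwise non-adjacent, so each needs its own clique and
-- every covering has at least k members.  Two divisors have a common factor
-- iff both are multiples of a common p i, so the k sets of multiples of the
-- p i form a covering.  In a covering by exactly k cliques each clique contains
-- exactly one p i; as it must also cover every edge at p i, it is the closed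
-- neighbourhood of p i, which is the set of its multiples.
module Submission where

open import Level using (0ℓ)
open import Data.Nat using (ℕ; zero; suc; _≤_; _<_; _^_; s≤s; _<?_)
open import Data.Nat using (>-nonZero; ≢-nonZero; nonTrivial⇒n>1)
open import Data.Nat.Divisibility using (_∣_; _∣?_; ∣-refl; ∣-trans; ∣⇒≤; m∣m*n; ∣1⇒≡1)
open import Data.Nat.GCD using (gcd; gcd[m,n]∣m; gcd[m,n]∣n; gcd-greatest; gcd[m,n]≢0)
open import Data.Nat.ListAction using (product)
open import Data.Nat.ListAction.Properties using (∈⇒∣product)
open import Data.Nat.Primality using (Prime; euclidsLemma; prime⇒irreducible; prime⇒nonTrivial)
open import Data.Nat.Primality.Factorisation using (factorise)
open import Data.Nat.Properties using (<-≤-trans; <-irrefl; <⇒≢; <⇒≤; ≤-reflexive; ≤-trans; 1+n≰n)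
open import Data.Fin using (Fin; zero; suc; toℕ; fromℕ<; punchOut; _≟_)
open import Data.Fin.Properties using (any?; injective⇒≤; punchOut-injective; toℕ-fromℕ<)
open import Data.Fin.Subset using (Subset; _∈_; _⊆_; _∩_)
open import Data.Fin.Subset.Properties using (⊆-antisym; x∈p∩q⁺; x∈p∩q⁻)
open import Data.List using (List; _∷_; []; tabulate; length; lookup)
open import Data.List.Membership.Propositional using () renaming (_∈_ to _∈ₗ_)
open import Data.List.Membership.Propositional.Properties using (∈-lookup; ∈-tabulate⁺; ∈-tabulate⁻)
open import Data.List.Properties using (length-tabulate)
open import Data.List.Relation.Binary.BagAndSetEquality using (_∼[_]_; set)
open import Data.List.Relation.Unary.All as All using (_∷_)
import Data.List.Relation.Unary.All.Properties as All
open import Data.List.Relation.Unary.Any using (index)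
import Data.List.Relation.Unary.Any.Properties as Any
import Data.List.Relation.Unary.Unique.Propositional.Properties as Unique
open import Data.Product using (_×_; _,_; ∃; proj₁; proj₂)
open import Data.Sum using (inj₁; inj₂; [_,_]′)
import Data.Vec as Vec
open import Data.Vec.Properties using (lookup∘tabulate; lookup⇒[]=; []=⇒lookup)
open import Function using (_∘_; mk⇔)
open import Function.Definitions using (Injective)
open import Relation.Binary.PropositionalEquality using (_≡_; _≢_; refl; sym; trans; cong; subst)
open import Relation.Nullary using (¬_; yes; no; does; contradiction)
open import Relation.Nullary.Decidable using (dec-true; decidable-stable; _×-dec_)
open import Relation.Unary using (Pred; Decidable)
open import Defs

-- Finite injections and decidable subsets.

injective∧≤⇒surjective : ∀ {m n} {f : Fin m → Fin n} → Injective _≡_ _≡_ f → n ≤ m →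
  ∀ j → ∃ λ i → f i ≡ j
injective∧≤⇒surjective {n = suc _} {f} f-inj n≤m j with any? (λ i → f i ≟ j)
... | yes hit = hit
-- Deleting a missed `j` from the codomain leaves an injection into a set of size `n` minus one, too
-- small for `m`.
... | no ¬hit = contradiction (≤-trans n≤m (injective⇒≤ avoid-inj)) 1+n≰n
  where
  j≢f : ∀ i → j ≢ f i
  j≢f i j≡fi = ¬hit (i , sym j≡fi)

  avoid-inj : Injective _≡_ _≡_ (λ i → punchOut (j≢f i))
  avoid-inj {a} {b} eq = f-inj (punchOut-injective (j≢f a) (j≢f b) eq)

module _ {m} {P : Pred (Fin m) 0ℓ} (P? : Decidable P) where

  ∈-tabulate-does⁺ : ∀ {i} → P i → i ∈ Vec.tabulate (does ∘ P?)
  ∈-tabulate-does⁺ {i} Pi =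
    lookup⇒[]= i _ (trans (lookup∘tabulate (does ∘ P?) i) (dec-true (P? i) Pi))

  ∈-tabulate-does⁻ : ∀ {i} → i ∈ Vec.tabulate (does ∘ P?) → P i
  -- Abstracting `P? i` in the equation as well turns its `no` case into `false ≡ true`, so only
  -- `yes` remains.
  ∈-tabulate-does⁻ {i} i∈ with P? i | trans (sym (lookup∘tabulate (does ∘ P?) i)) ([]=⇒lookup i∈)
  ... | yes Pi | _ = Pi

-- Independent vertices whose closed neighbourhoods are cliques that cover.

module ClosedNeighbourhoodCovering {m k} (Γ : SimpleGraph m)
  (x : Fin k → Fin m) (x-injective : Injective _≡_ _≡_ x)
  (x-vertex : ∀ i → x i ∈ vertices Γ)
  (x-independent : ∀ {i j} → ¬ Adj Γ (x i) (x j))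
  -- `x∈N`, `neighbour∈N` and `N-clique` together force `N i` to be the closed neighbourhood of
  -- `x i`.
  (N : Fin k → Subset m)
  (x∈N : ∀ i → x i ∈ N i)
  (neighbour∈N : ∀ {i v} → Adj Γ (x i) v → v ∈ N i)
  (N-clique : ∀ i → IsClique Γ (N i))
  (N-covers-vertex : ∀ {v} → v ∈ vertices Γ → ∃ λ i → v ∈ N i)
  (N-covers-edge : ∀ {a b} → Adj Γ a b → ∃ λ i → a ∈ N i × b ∈ N i)
  where

  clique-separates : ∀ {C i j} → IsClique Γ C → x i ∈ C → x j ∈ C → i ≡ j
  clique-separates {i = i} {j} (_ , adj) xi∈C xj∈C = decidable-stable (i ≟ j) λ i≢j →
    x-independent (adj xi∈C xj∈C (i≢j ∘ x-injective))

  clique⊆N : ∀ {C i} → IsClique Γ C → x i ∈ C → C ⊆ N i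
  clique⊆N {i = i} (_ , adj) xi∈C {v} v∈C with x i ≟ v
  ... | yes refl = x∈N i
  ... | no xi≢v  = neighbour∈N (adj xi∈C v∈C xi≢v)

  N-injective : Injective _≡_ _≡_ N
  N-injective {i} {j} eq =
    clique-separates (N-clique j) (subst (x i ∈_) eq (x∈N i)) (x∈N j)

  neighbourhoods : List (Subset m)
  neighbourhoods = tabulate N

  neighbourhoods-covering : IsTotalCliqueCovering Γ neighbourhoods
  neighbourhoods-covering = record
    { distinct      = Unique.tabulate⁺ N-injective
    ; cliques       = All.tabulate⁺ N-clique
    ; covers-vertex = λ v∈ → let i , v∈N = N-covers-vertex v∈ in Any.tabulate⁺ i v∈N
    ; covers-edge   = λ ab → let i , ab∈N = N-covers-edge ab in Any.tabulate⁺ i ab∈N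
    }

  module _ {S : List (Subset m)} (covering : IsTotalCliqueCovering Γ S) where
    open IsTotalCliqueCovering covering

    -- A choice of one member of `S` through each `x i`; when `S` has only `k` members, the choice
    -- turns out to be forced.
    position : Fin k → Fin (length S)
    position i = index (covers-vertex (x-vertex i))

    x∈position : ∀ i → x i ∈ lookup S (position i)
    x∈position i = Any.lookup-index (covers-vertex (x-vertex i))

    lookup-clique : ∀ a → IsClique Γ (lookup S a)
    lookup-clique a = All.lookup cliques (∈-lookup a)

    position-injective : Injective _≡_ _≡_ position
    position-injective {i} {j} eq = clique-separates (lookup-clique (position j))
      (subst (λ a → x i ∈ lookup S a) eq (x∈position i)) (x∈position j)

    k≤length : k ≤ length S
    k≤length = injective⇒≤ position-injective

    module _ (length≤k : length S ≤ k) where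

      position-surjective : ∀ a → ∃ λ i → position i ≡ a
      position-surjective = injective∧≤⇒surjective position-injective length≤k

      -- By surjectivity the clique at `a` was already chosen for some `x j`. It cannot contain two
      -- of the independent vertices, so `j` is `i`.
      x∈lookup⇒position : ∀ {i a} → x i ∈ lookup S a → a ≡ position i
      x∈lookup⇒position {i} {a} xi∈ with position-surjective a
      ... | j , refl = cong position (clique-separates (lookup-clique a) (x∈position j) xi∈)

      N⊆lookup : ∀ i → N i ⊆ lookup S (position i)
      N⊆lookup i {v} v∈N with x i ≟ v
      ... | yes refl = x∈position i
      ... | no xi≢v  =
        -- Some clique of `S` covers the edge from `x i` to `v`. As it contains `x i`, it is the one
        -- at `position i`.
        let edge     = covers-edge (proj₂ (N-clique i) (x∈N i) v∈N xi≢v)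
            xi∈ , v∈ = Any.lookup-index edge
        in subst (λ a → v ∈ lookup S a) (x∈lookup⇒position xi∈) v∈

      N≡lookup : ∀ i → N i ≡ lookup S (position i)
      N≡lookup i =
        ⊆-antisym (N⊆lookup i) (clique⊆N (lookup-clique (position i)) (x∈position i))

      neighbourhoods∼S : neighbourhoods ∼[ set ] S
      neighbourhoods∼S {C} = mk⇔ to from
        where
        to : C ∈ₗ neighbourhoods → C ∈ₗ S
        to C∈ with ∈-tabulate⁻ C∈
        ... | i , refl = subst (_∈ₗ S) (sym (N≡lookup i)) (∈-lookup (position i))

        from : C ∈ₗ S → C ∈ₗ neighbourhoods
        -- No member of `S` is left over: each sits at some `position i` and so equals `N i`.
        from C∈S with position-surjective (index C∈S)
        ... | i , eq = subst (_∈ₗ neighbourhoods)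
          (trans (N≡lookup i) (trans (cong (lookup S) eq) (sym (Any.lookup-index C∈S))))
          (∈-tabulate⁺ i)

  coveringNumber : IsTotalCliqueCoveringNumber Γ k
  coveringNumber =
      (neighbourhoods , neighbourhoods-covering , length-tabulate N)
    , λ S covering → k≤length covering

  uniqueCovering : UniqueTotalCliqueCoveringOfSize Γ k
  uniqueCovering = neighbourhoods
    , (neighbourhoods-covering , length-tabulate N)
    , λ (covering , length≡k) → neighbourhoods∼S covering (≤-reflexive length≡k)

-- Prime divisors of powers, products and gcds.

prime⇒>1 : ∀ {p} → Prime p → 1 < p
prime⇒>1 {p} pp = nonTrivial⇒n>1 p {{prime⇒nonTrivial pp}}

prime∣prime⇒≡ : ∀ {p q} → Prime p → Prime q → p ∣ q → p ≡ q
prime∣prime⇒≡ pp pq p∣q with prime⇒irreducible pq p∣q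
... | inj₁ p≡1 = contradiction (sym p≡1) (<⇒≢ (prime⇒>1 pp))
... | inj₂ p≡q = p≡q

prime∣^⇒∣ : ∀ {q} → Prime q → ∀ m r → q ∣ m ^ r → q ∣ m
prime∣^⇒∣ pq m zero    q∣1 = contradiction (sym (∣1⇒≡1 q∣1)) (<⇒≢ (prime⇒>1 pq))
prime∣^⇒∣ pq m (suc r) q∣  = [ (λ q∣m → q∣m) , prime∣^⇒∣ pq m r ]′ (euclidsLemma m (m ^ r) pq q∣)

prime∣product-tabulate⇒∃∣ : ∀ {q} → Prime q → ∀ {k} (f : Fin k → ℕ) →
  q ∣ product (tabulate f) → ∃ λ i → q ∣ f i
prime∣product-tabulate⇒∃∣ pq {zero}  f q∣1 = contradiction (sym (∣1⇒≡1 q∣1)) (<⇒≢ (prime⇒>1 pq))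
prime∣product-tabulate⇒∃∣ pq {suc k} f q∣ with euclidsLemma (f zero) _ pq q∣
... | inj₁ q∣f0 = zero , q∣f0
... | inj₂ q∣fs = let i , q∣fi = prime∣product-tabulate⇒∃∣ pq (f ∘ suc) q∣fs in suc i , q∣fi

>1⇒∃prime∣ : ∀ {d} → 1 < d → ∃ λ q → Prime q × q ∣ d
-- The successor pattern supplies the nonzero instance that `factorise` requires; an empty
-- factorisation would give `d` the value 1.
>1⇒∃prime∣ {d@(suc _)} 1<d with factorise d
... | record { factors = [] ; isFactorisation = refl } = contradiction 1<d (<-irrefl refl)
... | record { factors = q ∷ qs ; isFactorisation = eq ; factorsPrime = pq ∷ _ } =
  q , pq , subst (q ∣_) (sym eq) (m∣m*n (product qs))

1<gcd[p,m]⇒p∣m : ∀ {p m} → Prime p → 1 < gcd p m → p ∣ m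
1<gcd[p,m]⇒p∣m {p} {m} pp 1<g with prime⇒irreducible pp (gcd[m,n]∣m p m)
... | inj₁ g≡1 = contradiction (sym g≡1) (<⇒≢ 1<g)
... | inj₂ g≡p = subst (_∣ m) g≡p (gcd[m,n]∣n p m)

module _ {n : ℕ} where

  ∈-divisors>1⁺ : ∀ {v} → 1 < toℕ v → toℕ v ∣ n → v ∈ divisors>1 n
  ∈-divisors>1⁺ 1<v v∣n = ∈-tabulate-does⁺ (λ i → 1 <? toℕ i ×-dec toℕ i ∣? n) (1<v , v∣n)

  ∈-divisors>1⁻ : ∀ {v} → v ∈ divisors>1 n → 1 < toℕ v × toℕ v ∣ n
  ∈-divisors>1⁻ = ∈-tabulate-does⁻ (λ i → 1 <? toℕ i ×-dec toℕ i ∣? n)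

multiples : ∀ m → ℕ → Subset m
multiples m d = Vec.tabulate (λ i → does (d ∣? toℕ i))

-- The divisor graph and its sets of multiples.

module DivisorGraph (n k : ℕ) (p r : Fin k → ℕ)
  (p-prime : ∀ i → Prime (p i)) (p-injective : Injective _≡_ _≡_ p) (1≤r : ∀ i → 1 ≤ r i)
  (n≡∏ : n ≡ product (tabulate (λ i → p i ^ r i))) (2≤n : 2 ≤ n)
  where

  p∣n : ∀ i → p i ∣ n
  p∣n i = subst (p i ∣_) (sym n≡∏) (∣-trans (m∣m^r (1≤r i)) (∈⇒∣product (∈-tabulate⁺ i)))
    where
    m∣m^r : ∀ {m r} → 1 ≤ r → m ∣ m ^ r
    m∣m^r {m} {suc r} _ = m∣m*n (m ^ r)

  -- A prime factor of `d` divides `n`, hence some `p i ^ r i`, hence equals `p i`. This serves both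
  -- for vertices and for the gcd of an edge.
  >1∧∣n⇒∃p∣ : ∀ {d} → 1 < d → d ∣ n → ∃ λ i → p i ∣ d
  >1∧∣n⇒∃p∣ 1<d d∣n =
    let q , pq , q∣d = >1⇒∃prime∣ 1<d
        i , q∣pʳ     = prime∣product-tabulate⇒∃∣ pq _ (subst (q ∣_) n≡∏ (∣-trans q∣d d∣n))
        q≡p          = prime∣prime⇒≡ pq (p-prime i) (prime∣^⇒∣ pq (p i) (r i) q∣pʳ)
    in i , subst (_∣ _) q≡p q∣d

  p<1+n : ∀ i → p i < suc n
  p<1+n i = s≤s (∣⇒≤ {{>-nonZero (<⇒≤ 2≤n)}} (p∣n i))

  vertex : Fin k → Fin (suc n)
  vertex i = fromℕ< (p<1+n i)

  toℕ-vertex : ∀ i → toℕ (vertex i) ≡ p i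
  toℕ-vertex i = toℕ-fromℕ< (p<1+n i)

  vertex-injective : Injective _≡_ _≡_ vertex
  vertex-injective {i} {j} eq =
    p-injective (trans (sym (toℕ-vertex i)) (trans (cong toℕ eq) (toℕ-vertex j)))

  vertex∈ : ∀ i → vertex i ∈ divisors>1 n
  vertex∈ i = ∈-divisors>1⁺ (subst (1 <_) (sym (toℕ-vertex i)) (prime⇒>1 (p-prime i)))
                            (subst (_∣ n) (sym (toℕ-vertex i)) (p∣n i))

  N : Fin k → Subset (suc n)
  N i = divisors>1 n ∩ multiples (suc n) (p i)

  ∈N⁺ : ∀ {i v} → v ∈ divisors>1 n → p i ∣ toℕ v → v ∈ N i
  ∈N⁺ {i} v∈ p∣v = x∈p∩q⁺ (v∈ , ∈-tabulate-does⁺ (λ v → p i ∣? toℕ v) p∣v)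

  ∈N⁻ : ∀ {i v} → v ∈ N i → v ∈ divisors>1 n × p i ∣ toℕ v
  ∈N⁻ {i} v∈N = let v∈ , v∈mult = x∈p∩q⁻ (divisors>1 n) _ v∈N in
    v∈ , ∈-tabulate-does⁻ (λ v → p i ∣? toℕ v) v∈mult

  adjacent⇒p∣ : ∀ {i v} → Adj (G n) (vertex i) v → p i ∣ toℕ v
  adjacent⇒p∣ {i} {v} (_ , _ , _ , 1<g) =
    1<gcd[p,m]⇒p∣m (p-prime i) (subst (λ a → 1 < gcd a (toℕ v)) (toℕ-vertex i) 1<g)

  vertex-independent : ∀ {i j} → ¬ Adj (G n) (vertex i) (vertex j)
  -- Adjacency would give `p i ∣ p j`, hence equal primes, against the distinctness built into
  -- `Adj`.
  vertex-independent {i} {j} adj@(_ , _ , vi≢vj , _) = vi≢vj (cong vertex (p-injective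
    (prime∣prime⇒≡ (p-prime i) (p-prime j) (subst (p i ∣_) (toℕ-vertex j) (adjacent⇒p∣ adj)))))

  N-clique : ∀ i → IsClique (G n) (N i)
  N-clique i = proj₁ ∘ ∈N⁻ , λ {a} {b} a∈N b∈N a≢b →
    let a∈ , p∣a = ∈N⁻ a∈N
        b∈ , p∣b = ∈N⁻ b∈N
        1<a , _  = ∈-divisors>1⁻ a∈
        -- A nonzero gcd is at least its divisor `p i`, which exceeds 1.
        g≢0      = gcd[m,n]≢0 (toℕ a) (toℕ b) (inj₁ (λ a≡0 → contradiction (subst (1 <_) a≡0 1<a) λ ()))
    in a∈ , b∈ , a≢b ,
       <-≤-trans (prime⇒>1 (p-prime i)) (∣⇒≤ {{≢-nonZero g≢0}} (gcd-greatest p∣a p∣b))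

  N-covers-vertex : ∀ {v} → v ∈ divisors>1 n → ∃ λ i → v ∈ N i
  N-covers-vertex v∈ =
    let 1<v , v∣n = ∈-divisors>1⁻ v∈
        i , p∣v   = >1∧∣n⇒∃p∣ 1<v v∣n
    in i , ∈N⁺ v∈ p∣v

  N-covers-edge : ∀ {a b} → Adj (G n) a b → ∃ λ i → a ∈ N i × b ∈ N i
  N-covers-edge {a} {b} (a∈ , b∈ , _ , 1<g) =
    let g∣a     = gcd[m,n]∣m (toℕ a) (toℕ b)
        g∣b     = gcd[m,n]∣n (toℕ a) (toℕ b)
        -- The gcd divides `n` through `a`, so some `p i` divides it and with it both endpoints.
        i , p∣g = >1∧∣n⇒∃p∣ 1<g (∣-trans g∣a (proj₂ (∈-divisors>1⁻ a∈)))
    in i , ∈N⁺ a∈ (∣-trans p∣g g∣a) , ∈N⁺ b∈ (∣-trans p∣g g∣b)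

  open ClosedNeighbourhoodCovering (G n) vertex vertex-injective vertex∈ vertex-independent
    N (λ i → ∈N⁺ (vertex∈ i) (subst (p i ∣_) (sym (toℕ-vertex i)) ∣-refl))
    (λ adj → ∈N⁺ (proj₁ (proj₂ adj)) (adjacent⇒p∣ adj))
    N-clique N-covers-vertex N-covers-edge public
    using (coveringNumber; uniqueCovering)

theorem4 : (n k : ℕ) (p r : Fin k → ℕ) →
    (∀ i → Prime (p i)) →
    Injective _≡_ _≡_ p →
    (∀ i → 1 ≤ r i) →
    n ≡ product (tabulate (λ i → p i ^ r i)) →
    2 ≤ n →
    IsTotalCliqueCoveringNumber (G n) k × UniqueTotalCliqueCoveringOfSize (G n) k
theorem4 n k p r p-prime p-injective 1≤r n≡∏ 2≤n = coveringNumber , uniqueCovering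
  where open DivisorGraph n k p r p-prime p-injective 1≤r n≡∏ 2≤n
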